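{- Let $s,t$ be positive integers and let $M$ be an $(s,t)$-spike of order $m\ge s+t$. Then there is a sequence of matroids $M_0,M_1,\dots,M_{s+t-2}$ with $M_{s+t-2}=M$ such that $M_0$ is a $(1,1)$-spike of order $m$, for each $i\in\{1,\dots,t-1\}$ the matroid $M_i$ is obtained from $M_{i-1}$ by a quotient step, and for each $i\in\{t,\dots,s+t-2\}$ the matroid $M_i$ is obtained from $M_{i-1}$ by a dual step. (That is, $M$ is obtained from a $(1,1)$-spike of order $m$ by applying the quotient step $t-1$ times followed by the dual step $s-1$ times.)
   Context: For positive integers $s,t$, an $(s,t)$-spike of order $m$ is a matroid $N$ with $m\ge\max\{s,t\}$ together with an associated partition $(A_1,\dots,A_m)$ of $E(N)$ into $2$-element sets (arms) such that the union of any $s$ arms is a circuit of $N$ and the union of any $t$ arms is a cocircuit of $N$. Quotient step: let $N$ be an $(s',t')$-spike of order $m\ge s'+t'$ with associated partition $(A_1,\dots,A_m)$; let $N+e$ be a single-element extension of $N$ by a new element $e$ such that, for every cocircuit $C^*$ of $N$ that is the union of $t'$ arms, $e\notin \mathrm{cl}_{N+e}(E(N)-C^*)$; the matroid $(N+e)/e$ is said to be obtained from $N$ by a quotient step. Dual step: for an $(s',t')$-spike $N$ of order $m\ge s'+t'$, the dual $N^*$ is a $(t',s')$-spike of order $m$ with the same associated partition; if $N''$ is obtained from $N^*$ by a quotient step, then $(N'')^*$ is said to be obtained from $N$ by a dual step. -}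

module Defs where

open import Level using (Level; 0ℓ) renaming (suc to lsuc)
open import Data.Nat using (ℕ; zero; suc; _+_; _∸_; _≤_; _<_; _⊔_)
open import Data.Bool using (Bool; true; false)
open import Data.Fin using (Fin; zero; suc)
open import Data.Fin.Subset using (Subset; _∈_; _∉_; _⊆_; _⊂_; _∪_; _∩_; ∁; ⁅_⁆; ∣_∣; ⊥)
open import Data.Vec using (_∷_; tabulate; lookup)
open import Data.Product using (Σ; ∃; _×_; _,_)
open import Data.Sum using (_⊎_)
open import Relation.Nullary using (¬_)
open import Relation.Binary.PropositionalEquality using (_≡_)

record Matroid (n : ℕ) : Set₁ where
  field
    Indep     : Subset n → Set
    indep-⊥   : Indep ⊥
    indep-⊆   : ∀ {I J} → J ⊆ I → Indep I → Indep J
    indep-aug : ∀ {I J} → Indep I → Indep J → ∣ I ∣ < ∣ J ∣ →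
                ∃ λ x → x ∈ J × x ∉ I × Indep (I ∪ ⁅ x ⁆)

open Matroid public

module _ {n : ℕ} where

  SameMatroid : Matroid n → Matroid n → Set
  SameMatroid M N = ∀ X → (Indep M X → Indep N X) × (Indep N X → Indep M X)

  IsBasis : Matroid n → Subset n → Set
  IsBasis M B = Indep M B × (∀ I → Indep M I → B ⊆ I → I ≡ B)

  Circuit : Matroid n → Subset n → Set
  Circuit M C = ¬ Indep M C × (∀ Y → Y ⊂ C → Indep M Y)

  DualIndep : Matroid n → Subset n → Set
  DualIndep M X = ∃ λ B → IsBasis M B × X ⊆ ∁ B

  IsDualOf : Matroid n → Matroid n → Set
  IsDualOf M D = ∀ X → (Indep D X → DualIndep M X) × (DualIndep M X → Indep D X)

  Cocircuit : Matroid n → Subset n → Set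
  Cocircuit M C = ¬ DualIndep M C × (∀ Y → Y ⊂ C → DualIndep M Y)

  HasRank : Matroid n → Subset n → ℕ → Set
  HasRank M X k = (∃ λ I → I ⊆ X × Indep M I × ∣ I ∣ ≡ k)
                × (∀ I → I ⊆ X → Indep M I → ∣ I ∣ ≤ k)

  InClosure : Matroid n → Subset n → Fin n → Set
  InClosure M X x = ∃ λ k → HasRank M X k × HasRank M (X ∪ ⁅ x ⁆) k

-- Spikes.  The associated partition (A_1,…,A_m) is given by the map
-- arm : Fin n → Fin m sending an element to the index of its arm.

module _ {n m : ℕ} where

  unionArms : (Fin n → Fin m) → Subset m → Subset n
  unionArms arm S = tabulate (λ x → lookup S (arm x))

  armSet : (Fin n → Fin m) → Fin m → Subset n
  armSet arm i = unionArms arm ⁅ i ⁆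

  IsSpike : Matroid n → ℕ → ℕ → (Fin n → Fin m) → Set
  IsSpike M s t arm =
      1 ≤ s × 1 ≤ t × s ⊔ t ≤ m
    × (∀ i → ∣ armSet arm i ∣ ≡ 2)
    × (∀ S → ∣ S ∣ ≡ s → Circuit M (unionArms arm S))
    × (∀ S → ∣ S ∣ ≡ t → Cocircuit M (unionArms arm S))

-- Single-element extensions and contraction of the new element.
-- An extension of a matroid on Fin n lives on Fin (suc n); the new element
-- e is zero, and the old element x is suc x.  A subset X of Fin n
-- corresponds to the subset (false ∷ X) of Fin (suc n).

module _ {n : ℕ} where

  IsExtension : Matroid (suc n) → Matroid n → Set
  IsExtension Ne N = ∀ X → (Indep Ne (false ∷ X) → Indep N X)
                         × (Indep N X → Indep Ne (false ∷ X))

  ContractIndep : Matroid (suc n) → Subset n → Set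
  ContractIndep Ne X = Indep Ne (true ∷ X)
                     ⊎ (¬ Indep Ne (true ∷ ⊥) × Indep Ne (false ∷ X))

  IsContractionOfNew : Matroid (suc n) → Matroid n → Set
  IsContractionOfNew Ne N' = ∀ X → (Indep N' X → ContractIndep Ne X)
                                 × (ContractIndep Ne X → Indep N' X)

module _ {n m : ℕ} where

  QuotStepWith : ℕ → ℕ → (Fin n → Fin m) → Matroid n → Matroid n → Set₁
  QuotStepWith s' t' arm N N' =
      IsSpike N s' t' arm × s' + t' ≤ m
    × Σ (Matroid (suc n)) λ Ne →
        IsExtension Ne N
      × (∀ S → ∣ S ∣ ≡ t' → ¬ InClosure Ne (false ∷ ∁ (unionArms arm S)) zero)
      × IsContractionOfNew Ne N'

  DualStepWith : ℕ → ℕ → (Fin n → Fin m) → Matroid n → Matroid n → Set₁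
  DualStepWith s' t' arm N N' =
      IsSpike N s' t' arm × s' + t' ≤ m
    × Σ (Matroid n) λ D → IsDualOf N D
    × Σ (Matroid n) λ N'' → QuotStepWith t' s' arm D N''
    × IsDualOf N'' N'

module _ {n : ℕ} where

  QuotStep : Matroid n → Matroid n → Set₁
  QuotStep N N' = ∃ λ m → Σ ℕ λ s' → Σ ℕ λ t' → Σ (Fin n → Fin m) λ arm →
                    QuotStepWith s' t' arm N N'

  DualStep : Matroid n → Matroid n → Set₁
  DualStep N N' = ∃ λ m → Σ ℕ λ s' → Σ ℕ λ t' → Σ (Fin n → Fin m) λ arm →
                    DualStepWith s' t' arm N N'

{-# OPTIONS --safe #-}
-- For a spike K of order m with s = k + 2, call an arm full in X when X contains it and touched when
-- X meets it, so that |X| = (touched arms) + (full arms).  A basis of K containing s − 1 arms and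
-- avoiding t − 1 others shows that r(K) = m + s − t.  The sets independent in K, of size below r(K),
-- and with at most s − 2 full arms are the independent sets of a matroid Q, which is the contraction
-- of the new element from the extension Ke of K by the modular cut of flats containing s − 1 arms.
-- Q is an (s − 1, t)-spike, and dually K* is the contraction of the new element from Ke*, which
-- extends Q*: this is a quotient step from Q* to K*, that is, a dual step from Q to K.  Applying it
-- to M reduces s to 1, and then applying it to duals reduces t to 1.
-- Independence is not assumed decidable; all case distinctions are on subsets and their sizes.

module Submission where

open import Defs
open import Data.Bool using (Bool; true; false; not; if_then_else_)
open import Data.Bool.Properties using (∨-identityʳ)
open import Data.Empty using (⊥-elim)
open import Data.Fin using (Fin; zero; suc)
open import Data.Fin.Properties using (any?; _≟_)
open import Data.Fin.Subset using (Subset; _∈_; _∉_; _⊆_; _∪_; _∩_; _-_; ∁; ⁅_⁆; ∣_∣; ⊥; ⊤)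
open import Data.Fin.Subset.Properties
open import Data.Nat using (ℕ; zero; suc; _+_; _∸_; _≤_; _<_; z≤n; s≤s; s≤s⁻¹; _≤?_)
open import Data.Nat.Properties hiding (_≟_)
open import Data.Nat.Solver using (module +-*-Solver)
open import Data.Product using (Σ; ∃; _×_; _,_; proj₁; proj₂)
open import Data.Sum using (inj₁; inj₂; [_,_]′)
open import Data.Vec using ([]; _∷_; here; there; lookup; tabulate)
open import Data.Vec.Properties using (lookup⇒[]=; []=⇒lookup; lookup∘tabulate; lookup-map)
open import Function using (_∘_; id)
open import Relation.Binary.PropositionalEquality using (_≡_; _≢_; refl; sym; trans; cong; cong₂; subst; subst₂; module ≡-Reasoning)
open import Relation.Nullary using (¬_; Dec; does; yes; no; ¬?; _×-dec_; contradiction)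

open import Algebra.Properties.CommutativeMonoid.Sum +-0-commutativeMonoid using (sum; sum-cong-≗; ∑-distrib-+)

-- Finite subsets and their sizes.

module _ {n : ℕ} where

  ⊈⇒∃ : (p q : Subset n) → ¬ (p ⊆ q) → ∃ λ x → x ∈ p × x ∉ q
  ⊈⇒∃ p q p⊈q with any? (λ x → x ∈? p ×-dec ¬? (x ∈? q))
  ... | yes w = w
  ... | no ¬w = ⊥-elim (p⊈q p⊆q)
    where
    p⊆q : p ⊆ q
    p⊆q {x} x∈p with x ∈? q
    ... | yes x∈q = x∈q
    ... | no x∉q = contradiction (x , x∈p , x∉q) ¬w

  larger⇒∃ : (p q : Subset n) → ∣ q ∣ < ∣ p ∣ → ∃ λ x → x ∈ p × x ∉ q
  larger⇒∃ p q q<p = ⊈⇒∃ p q λ p⊆q → <⇒≱ q<p (p⊆q⇒∣p∣≤∣q∣ p⊆q)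

  ⊆∧≥⇒≡ : {p q : Subset n} → p ⊆ q → ∣ q ∣ ≤ ∣ p ∣ → q ≡ p
  ⊆∧≥⇒≡ {p} {q} p⊆q q≤p with q ⊆? p
  ... | yes q⊆p = ⊆-antisym q⊆p p⊆q
  ... | no q⊈p = contradiction q≤p (<⇒≱ (p⊂q⇒∣p∣<∣q∣ (p⊆q , ⊈⇒∃ q p q⊈p)))

  ∪-least : {p q r : Subset n} → p ⊆ r → q ⊆ r → p ∪ q ⊆ r
  ∪-least {p} {q} p⊆r q⊆r = [ p⊆r , q⊆r ]′ ∘ x∈p∪q⁻ p q

  ⁅⁆⊆ : {x : Fin n} {p : Subset n} → x ∈ p → ⁅ x ⁆ ⊆ p
  ⁅⁆⊆ {x} {p} x∈p y∈x = subst (_∈ p) (sym (x∈⁅y⁆⇒x≡y x y∈x)) x∈p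

  x∈p∪⁅x⁆ : (x : Fin n) (p : Subset n) → x ∈ p ∪ ⁅ x ⁆
  x∈p∪⁅x⁆ x p = q⊆p∪q p ⁅ x ⁆ (x∈⁅x⁆ x)

  ∪-monoˡ : {p q : Subset n} (r : Subset n) → p ⊆ q → p ∪ r ⊆ q ∪ r
  ∪-monoˡ {p} {q} r p⊆q = ∪-least (p⊆p∪q r ∘ p⊆q) (q⊆p∪q q r)

  disjoint-sym : {p q : Subset n} → p ⊆ ∁ q → q ⊆ ∁ p
  disjoint-sym p⊆∁q x∈q = x∉p⇒x∈∁p λ x∈p → x∈∁p⇒x∉p (p⊆∁q x∈p) x∈q

  x∉p-x : {x : Fin n} (p : Subset n) → x ∉ p - x
  x∉p-x {x} p x∈ with ⊂-irref refl (⊂-⊆-trans (x∈p⇒p-x⊂p (p─q⊆p p ⁅ x ⁆ x∈)) (λ {y} y∈p → helper y∈p))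
    where
    helper : ∀ {y} → y ∈ p → y ∈ p - x
    helper {y} y∈p with y ∈? ⁅ x ⁆
    ... | yes y∈x = ⁅⁆⊆ x∈ y∈x
    ... | no y∉x = x∈p∧x≢y⇒x∈p-y y∈p (x∉⁅y⁆⇒x≢y y∉x)
  ... | ()

∣p∪q∣-disjoint : ∀ {n} (p q : Subset n) → p ⊆ ∁ q → ∣ p ∪ q ∣ ≡ ∣ p ∣ + ∣ q ∣
∣p∪q∣-disjoint [] [] _ = refl
∣p∪q∣-disjoint (true ∷ p) (true ∷ q) d with d here
... | ()
∣p∪q∣-disjoint (true ∷ p) (false ∷ q) d = cong suc (∣p∪q∣-disjoint p q (drop-there ∘ d ∘ there))
∣p∪q∣-disjoint (false ∷ p) (true ∷ q) d =
  trans (cong suc (∣p∪q∣-disjoint p q (drop-there ∘ d ∘ there))) (sym (+-suc ∣ p ∣ ∣ q ∣))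
∣p∪q∣-disjoint (false ∷ p) (false ∷ q) d = ∣p∪q∣-disjoint p q (drop-there ∘ d ∘ there)

module _ {n : ℕ} where

  ∣p∪⁅x⁆∣ : {x : Fin n} {p : Subset n} → x ∉ p → ∣ p ∪ ⁅ x ⁆ ∣ ≡ suc ∣ p ∣
  ∣p∪⁅x⁆∣ {x} {p} x∉p = trans (∣p∪q∣-disjoint p ⁅ x ⁆ (disjoint-sym (⁅⁆⊆ (x∉p⇒x∈∁p x∉p))))
    (trans (cong (∣ p ∣ +_) (∣⁅x⁆∣≡1 x)) (+-comm ∣ p ∣ 1))

  [p-x]∪⁅x⁆ : {x : Fin n} {p : Subset n} → x ∈ p → (p - x) ∪ ⁅ x ⁆ ≡ p
  [p-x]∪⁅x⁆ {x} {p} x∈p = ⊆-antisym (∪-least (p─q⊆p p ⁅ x ⁆) (⁅⁆⊆ x∈p)) back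
    where
    back : p ⊆ (p - x) ∪ ⁅ x ⁆
    back {y} y∈p with y ∈? ⁅ x ⁆
    ... | yes y∈x = q⊆p∪q (p - x) ⁅ x ⁆ y∈x
    ... | no y∉x = p⊆p∪q ⁅ x ⁆ (x∈p∧x≢y⇒x∈p-y y∈p (x∉⁅y⁆⇒x≢y y∉x))

  suc∣p-x∣ : {x : Fin n} {p : Subset n} → x ∈ p → suc ∣ p - x ∣ ≡ ∣ p ∣
  suc∣p-x∣ {x} {p} x∈p = trans (sym (∣p∪⁅x⁆∣ (x∉p-x p))) (cong ∣_∣ ([p-x]∪⁅x⁆ x∈p))

  ⊆-between : (p q : Subset n) (k : ℕ) → p ⊆ q → ∣ p ∣ ≤ k → k ≤ ∣ q ∣ →
              ∃ λ u → p ⊆ u × u ⊆ q × ∣ u ∣ ≡ k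
  ⊆-between p q k p⊆q p≤k k≤q = go (k ∸ ∣ p ∣) p p⊆q (m+[n∸m]≡n p≤k)
    where
    go : ∀ d (p : Subset n) → p ⊆ q → ∣ p ∣ + d ≡ k → ∃ λ u → p ⊆ u × u ⊆ q × ∣ u ∣ ≡ k
    go zero p p⊆q eq = p , id , p⊆q , trans (sym (+-identityʳ _)) eq
    go (suc d) p p⊆q eq
      with larger⇒∃ q p (≤-trans (m≤m+n (suc ∣ p ∣) d) (≤-trans (≤-reflexive (trans (sym (+-suc ∣ p ∣ d)) eq)) k≤q))
    ... | x , x∈q , x∉p
      with go d (p ∪ ⁅ x ⁆) (∪-least p⊆q (⁅⁆⊆ x∈q))
             (trans (cong (_+ d) (∣p∪⁅x⁆∣ x∉p)) (trans (sym (+-suc ∣ p ∣ d)) eq))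
    ... | u , p'⊆u , u⊆q , ∣u∣ = u , p'⊆u ∘ p⊆p∪q ⁅ x ⁆ , u⊆q , ∣u∣

-- Matroids and duality

module _ {n : ℕ} (M : Matroid n) where

  -- Repeated augmentation from `J`. The bound `L ⊆ I ∪ J` is what later shows that an extension
  -- still avoids a given set.
  extend : ∀ {I J} k → Indep M I → Indep M J → ∣ I ∣ ≤ k → k ≤ ∣ J ∣ →
           ∃ λ L → I ⊆ L × L ⊆ I ∪ J × Indep M L × ∣ L ∣ ≡ k
  extend {I} {J} k iI iJ I≤k k≤J = go (k ∸ ∣ I ∣) I iI id (p⊆p∪q J) (m+[n∸m]≡n I≤k)
    where
    go : ∀ d L → Indep M L → I ⊆ L → L ⊆ I ∪ J → ∣ L ∣ + d ≡ k →
         ∃ λ L → I ⊆ L × L ⊆ I ∪ J × Indep M L × ∣ L ∣ ≡ k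
    go zero L iL I⊆L L⊆ eq = L , I⊆L , L⊆ , iL , trans (sym (+-identityʳ _)) eq
    go (suc d) L iL I⊆L L⊆ eq
      with indep-aug M iL iJ (≤-trans (m≤m+n (suc ∣ L ∣) d) (≤-trans (≤-reflexive (trans (sym (+-suc ∣ L ∣ d)) eq)) k≤J))
    ... | x , x∈J , x∉L , iLx =
      go d (L ∪ ⁅ x ⁆) iLx (p⊆p∪q ⁅ x ⁆ ∘ I⊆L) (∪-least L⊆ (⁅⁆⊆ (q⊆p∪q I J x∈J)))
        (trans (cong (_+ d) (∣p∪⁅x⁆∣ x∉L)) (trans (sym (+-suc ∣ L ∣ d)) eq))

  -- The rank travels with an independent set attaining it: independence is not assumed decidable,
  -- so neither can be computed from the matroid.
  record Rank (r : ℕ) : Set where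
    field
      base       : Subset n
      base-indep : Indep M base
      base-size  : ∣ base ∣ ≡ r
      bound      : ∀ {I} → Indep M I → ∣ I ∣ ≤ r

  open Rank public

  basis⇒rank : ∀ {B} → IsBasis M B → Rank ∣ B ∣
  basis⇒rank {B} (iB , max) = record
    { base = B ; base-indep = iB ; base-size = refl ; bound = λ {I} iI → ≮⇒≥ λ B<I → absurd iI B<I }
    where
    absurd : ∀ {I} → Indep M I → ¬ (∣ B ∣ < ∣ I ∣)
    absurd iI B<I with indep-aug M iB iI B<I
    ... | x , _ , x∉B , iBx = x∉B (subst (x ∈_) (max _ iBx (p⊆p∪q ⁅ x ⁆)) (x∈p∪⁅x⁆ x B))

  module _ {r : ℕ} (rk : Rank r) where

    size⇒basis : ∀ {B} → Indep M B → ∣ B ∣ ≡ r → IsBasis M B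
    size⇒basis iB ∣B∣ = iB , λ I iI B⊆I → ⊆∧≥⇒≡ B⊆I (≤-trans (bound rk iI) (≤-reflexive (sym ∣B∣)))

    basis⇒size : ∀ {B} → IsBasis M B → ∣ B ∣ ≡ r
    basis⇒size b@(iB , _) = ≤-antisym (bound rk iB)
      (≤-trans (≤-reflexive (sym (base-size rk))) (bound (basis⇒rank b) (base-indep rk)))

    extend-to-basis : ∀ {I B} → Indep M I → IsBasis M B →
                      ∃ λ L → I ⊆ L × L ⊆ I ∪ B × IsBasis M L
    extend-to-basis {I} {B} iI b
      with extend r iI (proj₁ b) (bound rk iI) (≤-reflexive (sym (basis⇒size b)))
    ... | L , I⊆L , L⊆ , iL , ∣L∣ = L , I⊆L , L⊆ , size⇒basis iL ∣L∣

    -- Extend BY ─ X by BX to a basis B; it avoids X, so |X ∪ B| < |Y ∪ BY|, and an element of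
    -- Y ∪ BY outside X ∪ B must lie in Y.
    dual-aug : ∀ {X Y} → DualIndep M X → DualIndep M Y → ∣ X ∣ < ∣ Y ∣ →
               ∃ λ x → x ∈ Y × x ∉ X × DualIndep M (X ∪ ⁅ x ⁆)
    dual-aug {X} {Y} (BX , bX , X⊆) (BY , bY , Y⊆) X<Y
      with extend-to-basis (indep-⊆ M (p∩q⊆p BY (∁ X)) (proj₁ bY)) bX
    ... | B , I⊆B , B⊆ , bB = pick (larger⇒∃ (Y ∪ BY) (X ∪ B) smaller)
      where
      X⊆∁B : X ⊆ ∁ B
      X⊆∁B = disjoint-sym (∪-least (p∩q⊆q BY (∁ X)) (disjoint-sym X⊆) ∘ B⊆)
      smaller : ∣ X ∪ B ∣ < ∣ Y ∪ BY ∣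
      smaller rewrite ∣p∪q∣-disjoint X B X⊆∁B | ∣p∪q∣-disjoint Y BY Y⊆ | basis⇒size bB | basis⇒size bY =
        +-monoˡ-< r X<Y
      pick : (∃ λ x → x ∈ Y ∪ BY × x ∉ X ∪ B) → ∃ λ x → x ∈ Y × x ∉ X × DualIndep M (X ∪ ⁅ x ⁆)
      pick (x , x∈ , x∉) with x∈p∪q⁻ Y BY x∈
      ... | inj₁ x∈Y = x , x∈Y , x∉ ∘ p⊆p∪q B , B , bB ,
                       ∪-least X⊆∁B (⁅⁆⊆ (x∉p⇒x∈∁p (x∉ ∘ q⊆p∪q X B)))
      ... | inj₂ x∈BY = contradiction
              (q⊆p∪q X B (I⊆B (x∈p∩q⁺ (x∈BY , x∉p⇒x∈∁p (x∉ ∘ p⊆p∪q B))))) x∉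

    dual : Matroid n
    dual = record
      { Indep = DualIndep M
      ; indep-⊥ = base rk , size⇒basis (base-indep rk) (base-size rk) , ⊥-elim ∘ ∉⊥
      ; indep-⊆ = λ { J⊆I (B , b , I⊆) → B , b , I⊆ ∘ J⊆I }
      ; indep-aug = dual-aug
      }

    -- A coindependent set avoids some basis, and all bases have size `r`, so it has at most `n ∸ r`
    -- elements, the size of `∁ B`.
    ∁-basis : ∀ {B} → IsBasis M B → IsBasis dual (∁ B)
    ∁-basis {B} b = (B , b , id) , λ { I (B' , b' , I⊆) ∁B⊆I → ⊆∧≥⇒≡ ∁B⊆I
      (≤-trans (p⊆q⇒∣p∣≤∣q∣ I⊆) (≤-reflexive (trans (∣∁p∣≡n∸∣p∣ B')
        (trans (cong (n ∸_) (trans (basis⇒size b') (sym (basis⇒size b)))) (sym (∣∁p∣≡n∸∣p∣ B)))))) }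

    dual-involutive : IsDualOf dual M
    dual-involutive X = to , from
      where
      to : Indep M X → DualIndep dual X
      to iX with extend-to-basis iX (size⇒basis (base-indep rk) (base-size rk))
      ... | B , X⊆B , _ , b = ∁ B , ∁-basis b , λ x∈X → x∉p⇒x∈∁p (x∈p⇒x∉∁p (X⊆B x∈X))
      from : DualIndep dual X → Indep M X
      -- The dual basis `B*` lies in `∁ B` and hence equals it by maximality; `X` avoids it and so
      -- lies in `B`.
      from (B* , ((B , b , B*⊆) , max) , X⊆) = indep-⊆ M X⊆B (proj₁ b)
        where
        X⊆B : X ⊆ B
        X⊆B {x} x∈X = x∉∁p⇒x∈p (λ x∈∁B → x∈∁p⇒x∉p (X⊆ x∈X) (subst (x ∈_) (max (∁ B) (B , b , id) B*⊆) x∈∁B))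

-- Counting by arms

indicator : Bool → ℕ
indicator b = if b then 1 else 0

∣b∷p∣ : ∀ {n} b (p : Subset n) → ∣ b ∷ p ∣ ≡ indicator b + ∣ p ∣
∣b∷p∣ true p = refl
∣b∷p∣ false p = refl

∣p∣-as-sum : ∀ {n} (p : Subset n) → ∣ p ∣ ≡ sum (λ i → indicator (lookup p i))
∣p∣-as-sum [] = refl
∣p∣-as-sum (b ∷ p) = trans (∣b∷p∣ b p) (cong (indicator b +_) (∣p∣-as-sum p))

lookup-⁅⁆-sym : ∀ {n} (i j : Fin n) → lookup ⁅ i ⁆ j ≡ lookup ⁅ j ⁆ i
lookup-⁅⁆-sym zero zero = refl
lookup-⁅⁆-sym zero (suc j) = lookup-⊥ j
  where
  lookup-⊥ : ∀ {n} (j : Fin n) → lookup ⊥ j ≡ false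
  lookup-⊥ zero = refl
  lookup-⊥ (suc j) = lookup-⊥ j
lookup-⁅⁆-sym (suc i) zero = sym (lookup-⁅⁆-sym zero (suc i))
lookup-⁅⁆-sym (suc i) (suc j) = lookup-⁅⁆-sym i j

-- Stated for an arbitrary map, because the induction passes to `f ∘ suc`, whose fibres need not
-- have two elements.
∣p∣-by-fibres : ∀ {n m} (f : Fin n → Fin m) (p : Subset n) → ∣ p ∣ ≡ sum (λ i → ∣ p ∩ armSet f i ∣)
∣p∣-by-fibres {m = m} f [] = zeros m
  where
  zeros : ∀ m → 0 ≡ sum {m} (λ _ → 0)
  zeros zero = refl
  zeros (suc m) = zeros m
∣p∣-by-fibres f (false ∷ p) = ∣p∣-by-fibres (f ∘ suc) p
∣p∣-by-fibres f (true ∷ p) = begin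
  1 + ∣ p ∣
    ≡⟨ cong₂ _+_ (trans (sym (∣⁅x⁆∣≡1 (f zero))) (∣p∣-as-sum ⁅ f zero ⁆)) (∣p∣-by-fibres (f ∘ suc) p) ⟩
  sum (λ i → indicator (lookup ⁅ f zero ⁆ i)) + sum (λ i → ∣ p ∩ armSet (f ∘ suc) i ∣)
    ≡⟨ ∑-distrib-+ _ (λ i → ∣ p ∩ armSet (f ∘ suc) i ∣) ⟨
  sum (λ i → indicator (lookup ⁅ f zero ⁆ i) + ∣ p ∩ armSet (f ∘ suc) i ∣)
    ≡⟨ sum-cong-≗ (λ i → trans (cong (λ b → indicator b + ∣ p ∩ armSet (f ∘ suc) i ∣) (lookup-⁅⁆-sym (f zero) i))
                               (sym (∣b∷p∣ (lookup ⁅ i ⁆ (f zero)) (p ∩ armSet (f ∘ suc) i)))) ⟩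
  sum (λ i → ∣ (true ∷ p) ∩ armSet f i ∣) ∎
  where open ≡-Reasoning

∈-tabulate⁺ : ∀ {n} {f : Fin n → Bool} {i} → f i ≡ true → i ∈ tabulate f
∈-tabulate⁺ {f = f} {i} eq = lookup⇒[]= i (tabulate f) (trans (lookup∘tabulate f i) eq)

∈-tabulate⁻ : ∀ {n} {f : Fin n → Bool} {i} → i ∈ tabulate f → f i ≡ true
∈-tabulate⁻ {f = f} {i} i∈ = trans (sym (lookup∘tabulate f i)) ([]=⇒lookup i∈)

module Arms {n m : ℕ} (arm : Fin n → Fin m) (two : ∀ i → ∣ armSet arm i ∣ ≡ 2) where

  U : Subset m → Subset n
  U = unionArms arm

  ∈U⁺ : ∀ {S x} → arm x ∈ S → x ∈ U S
  ∈U⁺ = ∈-tabulate⁺ ∘ []=⇒lookup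

  ∈U⁻ : ∀ {S x} → x ∈ U S → arm x ∈ S
  ∈U⁻ {S} {x} x∈ = lookup⇒[]= (arm x) S (∈-tabulate⁻ x∈)

  U-mono : ∀ {S T} → S ⊆ T → U S ⊆ U T
  U-mono S⊆T = ∈U⁺ ∘ S⊆T ∘ ∈U⁻

  U-disjoint : ∀ {S T} → S ⊆ ∁ T → U S ⊆ ∁ (U T)
  U-disjoint S⊆∁T x∈ = x∉p⇒x∈∁p (x∈∁p⇒x∉p (S⊆∁T (∈U⁻ x∈)) ∘ ∈U⁻)

  arm-inhabited : ∀ i → ∃ λ x → arm x ≡ i
  arm-inhabited i
    with larger⇒∃ (armSet arm i) ⊥ (subst (_< ∣ armSet arm i ∣) (sym (∣⊥∣≡0 n)) (subst (0 <_) (sym (two i)) (s≤s z≤n)))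
  ... | x , x∈ , _ = x , x∈⁅y⁆⇒x≡y i (∈U⁻ x∈)

  ∈arm : ∀ x → x ∈ armSet arm (arm x)
  ∈arm x = ∈U⁺ (x∈⁅x⁆ (arm x))

  opaque
    -- An arm meets `X` exactly when it is not contained in `∁ X`. This form ties the touched arms
    -- of a basis to the full arms of its complement, where the cocircuits give information.
    full touched : Subset n → Subset m
    full X = tabulate (λ i → does (armSet arm i ⊆? X))
    touched X = ∁ (full (∁ X))

    full⁺ : ∀ {X i} → armSet arm i ⊆ X → i ∈ full X
    full⁺ {X} {i} A⊆X = ∈-tabulate⁺ (go (armSet arm i ⊆? X))
      where
      go : (d : Dec (armSet arm i ⊆ X)) → does d ≡ true
      go (yes _) = refl
      go (no A⊈X) = ⊥-elim (A⊈X A⊆X)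

    full⁻ : ∀ {X i} → i ∈ full X → armSet arm i ⊆ X
    full⁻ {X} {i} i∈ = go (armSet arm i ⊆? X) (∈-tabulate⁻ i∈)
      where
      go : (d : Dec (armSet arm i ⊆ X)) → does d ≡ true → armSet arm i ⊆ X
      go (yes A⊆X) _ = A⊆X

    touched⁺ : ∀ {X x} → x ∈ X → arm x ∈ touched X
    touched⁺ {X} {x} x∈X = x∉p⇒x∈∁p λ i∈ → x∈∁p⇒x∉p (full⁻ i∈ (∈arm x)) x∈X

    touched⁻ : ∀ {X i} → i ∈ touched X → ∃ λ x → x ∈ X × arm x ≡ i
    touched⁻ {X} {i} i∈ with ⊈⇒∃ (armSet arm i) (∁ X) (λ A⊆ → x∈∁p⇒x∉p i∈ (full⁺ A⊆))
    ... | x , x∈A , x∉∁X = x , x∉∁p⇒x∈p x∉∁X , x∈⁅y⁆⇒x≡y i (∈U⁻ x∈A)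

    ∣touched∣ : ∀ X → ∣ touched X ∣ ≡ m ∸ ∣ full (∁ X) ∣
    ∣touched∣ X = ∣∁p∣≡n∸∣p∣ (full (∁ X))

    -- A two-element arm contributes 0, 1 or 2 elements to `X` as it is untouched, touched but not
    -- full, or full.
    ∣X∩A∣ : ∀ X i → ∣ X ∩ armSet arm i ∣ ≡ indicator (lookup (touched X) i) + indicator (lookup (full X) i)
    ∣X∩A∣ X i rewrite lookup-map i not (full (∁ X))
                    | lookup∘tabulate (λ i → does (armSet arm i ⊆? ∁ X)) i
                    | lookup∘tabulate (λ i → does (armSet arm i ⊆? X)) i
      with armSet arm i ⊆? ∁ X | armSet arm i ⊆? X
    ... | yes A⊆∁X | yes A⊆X = ⊥-elim (x∈∁p⇒x∉p (A⊆∁X x∈A) (A⊆X x∈A))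
      where
      x∈A : proj₁ (arm-inhabited i) ∈ armSet arm i
      x∈A = subst (λ j → proj₁ (arm-inhabited i) ∈ armSet arm j) (proj₂ (arm-inhabited i)) (∈arm _)
    ... | yes A⊆∁X | no _ = trans (cong ∣_∣ (⊆-antisym empty (⊥-elim ∘ ∉⊥))) (∣⊥∣≡0 n)
      where
      empty : X ∩ armSet arm i ⊆ ⊥
      empty x∈ with x∈p∩q⁻ X (armSet arm i) x∈
      ... | x∈X , x∈A = ⊥-elim (x∈∁p⇒x∉p (A⊆∁X x∈A) x∈X)
    ... | no _ | yes A⊆X = trans (cong ∣_∣ (⊆-antisym (p∩q⊆q X _) (λ x∈A → x∈p∩q⁺ (A⊆X x∈A , x∈A)))) (two i)
    ... | no A⊈∁X | no A⊈X with ⊈⇒∃ _ _ A⊈∁X | ⊈⇒∃ _ _ A⊈X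
    ...   | x , x∈A , x∉∁X | y , y∈A , y∉X = ≤-antisym
            (s≤s⁻¹ (subst (∣ X ∩ armSet arm i ∣ <_) (two i)
              (p⊂q⇒∣p∣<∣q∣ (p∩q⊆q X (armSet arm i) , y , y∈A , y∉X ∘ proj₁ ∘ x∈p∩q⁻ X _))))
            (subst (_≤ ∣ X ∩ armSet arm i ∣) (∣⁅x⁆∣≡1 x) (p⊆q⇒∣p∣≤∣q∣ (⁅⁆⊆ (x∈p∩q⁺ (x∉∁p⇒x∈p x∉∁X , x∈A)))))

  full-mono : ∀ {X Y} → X ⊆ Y → full X ⊆ full Y
  full-mono X⊆Y i∈ = full⁺ (X⊆Y ∘ full⁻ i∈)

  full-U : ∀ {S} → S ⊆ full (U S)
  full-U i∈S = full⁺ (U-mono (⁅⁆⊆ i∈S))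

  U-full : ∀ {X} → U (full X) ⊆ X
  U-full {X} {x} x∈ = full⁻ (∈U⁻ x∈) (∈arm x)

  full-⊆ : ∀ {X S} → X ⊆ U S → full X ⊆ S
  full-⊆ {X} {S} X⊆ {i} i∈ with arm-inhabited i
  ... | x , refl = ∈U⁻ (X⊆ (full⁻ i∈ (∈arm x)))

  touched-mono : ∀ {X Y} → X ⊆ Y → touched X ⊆ touched Y
  touched-mono X⊆Y i∈ with touched⁻ i∈
  ... | x , x∈X , refl = touched⁺ (X⊆Y x∈X)

  ⊆-U-touched : ∀ {X} → X ⊆ U (touched X)
  ⊆-U-touched = ∈U⁺ ∘ touched⁺

  size : ∀ X → ∣ X ∣ ≡ ∣ touched X ∣ + ∣ full X ∣
  size X = begin
    ∣ X ∣                                                        ≡⟨ ∣p∣-by-fibres arm X ⟩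
    sum (λ i → ∣ X ∩ armSet arm i ∣)                             ≡⟨ sum-cong-≗ (∣X∩A∣ X) ⟩
    sum (λ i → indicator (lookup (touched X) i) + indicator (lookup (full X) i))
      ≡⟨ ∑-distrib-+ (λ i → indicator (lookup (touched X) i)) _ ⟩
    sum (λ i → indicator (lookup (touched X) i)) + sum (λ i → indicator (lookup (full X) i))
      ≡⟨ cong₂ _+_ (∣p∣-as-sum (touched X)) (∣p∣-as-sum (full X)) ⟨
    ∣ touched X ∣ + ∣ full X ∣ ∎
    where open ≡-Reasoning

  full-∪⁅x⁆ : ∀ {X x} → x ∉ X → ∣ full (X ∪ ⁅ x ⁆) ∣ ≤ suc ∣ full X ∣
  full-∪⁅x⁆ {X} {x} x∉X = +-cancelˡ-≤ ∣ touched X ∣ _ _ (begin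
    ∣ touched X ∣ + ∣ full (X ∪ ⁅ x ⁆) ∣
      ≤⟨ +-monoˡ-≤ ∣ full (X ∪ ⁅ x ⁆) ∣ (p⊆q⇒∣p∣≤∣q∣ (touched-mono {X} (p⊆p∪q ⁅ x ⁆))) ⟩
    ∣ touched (X ∪ ⁅ x ⁆) ∣ + ∣ full (X ∪ ⁅ x ⁆) ∣  ≡⟨ size (X ∪ ⁅ x ⁆) ⟨
    ∣ X ∪ ⁅ x ⁆ ∣                                  ≡⟨ ∣p∪⁅x⁆∣ x∉X ⟩
    suc ∣ X ∣                                      ≡⟨ cong suc (size X) ⟩
    suc (∣ touched X ∣ + ∣ full X ∣)                ≡⟨ +-suc ∣ touched X ∣ ∣ full X ∣ ⟨
    ∣ touched X ∣ + suc ∣ full X ∣                  ∎)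
    where open ≤-Reasoning

  -- The newly touched arm accounts for the whole increase in size, leaving nothing for a new full
  -- arm.
  full-∪⁅x⁆-untouched : ∀ {X x} → arm x ∉ touched X → ∣ full (X ∪ ⁅ x ⁆) ∣ ≤ ∣ full X ∣
  full-∪⁅x⁆-untouched {X} {x} i∉ = +-cancelˡ-≤ (suc ∣ touched X ∣) _ _ (begin
    suc ∣ touched X ∣ + ∣ full (X ∪ ⁅ x ⁆) ∣        ≡⟨ cong (_+ ∣ full (X ∪ ⁅ x ⁆) ∣) (∣p∪⁅x⁆∣ i∉) ⟨
    ∣ touched X ∪ ⁅ arm x ⁆ ∣ + ∣ full (X ∪ ⁅ x ⁆) ∣
      ≤⟨ +-monoˡ-≤ ∣ full (X ∪ ⁅ x ⁆) ∣ (p⊆q⇒∣p∣≤∣q∣ (∪-least (touched-mono {X} (p⊆p∪q ⁅ x ⁆)) (⁅⁆⊆ (touched⁺ (x∈p∪⁅x⁆ x X))))) ⟩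
    ∣ touched (X ∪ ⁅ x ⁆) ∣ + ∣ full (X ∪ ⁅ x ⁆) ∣  ≡⟨ size (X ∪ ⁅ x ⁆) ⟨
    ∣ X ∪ ⁅ x ⁆ ∣                                  ≡⟨ ∣p∪⁅x⁆∣ (i∉ ∘ touched⁺) ⟩
    suc ∣ X ∣                                      ≡⟨ cong suc (size X) ⟩
    suc ∣ touched X ∣ + ∣ full X ∣                  ∎)
    where open ≤-Reasoning

  -- With at most `k` full arms any element will do; otherwise an element of a full arm is removed,
  -- which stops that arm from being full.
  remove-from-full : ∀ {X k} → 0 < ∣ X ∣ → ∣ full X ∣ ≤ suc k → ∃ λ x → x ∈ X × ∣ full (X - x) ∣ ≤ k
  remove-from-full {X} {k} 0<X f≤ with ∣ full X ∣ ≤? k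
  ... | yes f≤k with larger⇒∃ X ⊥ (subst (_< ∣ X ∣) (sym (∣⊥∣≡0 n)) 0<X)
  ...   | x , x∈X , _ = x , x∈X , ≤-trans (p⊆q⇒∣p∣≤∣q∣ (full-mono (p─q⊆p X ⁅ x ⁆))) f≤k
  remove-from-full {X} {k} 0<X f≤ | no f≰k
    with larger⇒∃ (full X) ⊥ (subst (_< ∣ full X ∣) (sym (∣⊥∣≡0 m)) (≤-trans (s≤s z≤n) (≰⇒> f≰k)))
  ... | i , i∈ , _ with arm-inhabited i
  ...   | x , refl = x , full⁻ i∈ (∈arm x) , s≤s⁻¹ (≤-trans (p⊂q⇒∣p∣<∣q∣
            (full-mono (p─q⊆p X ⁅ x ⁆) , arm x , i∈ , λ i∈' → x∉p-x X (full⁻ i∈' (∈arm x)))) f≤)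

  -- By `size`, the hypothesis says that `J` touches more arms than `I`.
  larger-touches-more : ∀ {I J} → ∣ touched I ∣ + ∣ full J ∣ < ∣ J ∣ → ∃ λ x → x ∈ J × arm x ∉ touched I
  larger-touches-more {I} {J} lt
    with larger⇒∃ (touched J) (touched I) (+-cancelʳ-< ∣ full J ∣ _ _ (subst (∣ touched I ∣ + ∣ full J ∣ <_) (size J) lt))
  ... | i , i∈ , i∉ with touched⁻ i∈
  ...   | x , x∈J , refl = x , x∈J , i∉

-- Spikes

module _ {n m : ℕ} {arm : Fin n → Fin m} (two : ∀ i → ∣ armSet arm i ∣ ≡ 2) where
  open Arms arm two

  -- More than `k` full arms would contain a circuit. Applied to the dual, this bounds the full arms
  -- of a coindependent set.
  full-bound : ∀ (N : Matroid n) {k I} → (∀ S → ∣ S ∣ ≡ suc k → Circuit N (U S)) →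
               Indep N I → ∣ full I ∣ ≤ k
  full-bound N {k} {I} circ iI = ≮⇒≥ absurd
    where
    absurd : ¬ (k < ∣ full I ∣)
    absurd k<f with ⊆-between ⊥ (full I) (suc k) (⊥-elim ∘ ∉⊥) (subst (_≤ suc k) (sym (∣⊥∣≡0 m)) z≤n) k<f
    ... | S , _ , S⊆ , ∣S∣ = proj₁ (circ S ∣S∣) (indep-⊆ N (U-full ∘ U-mono S⊆) iI)

  few-arms-indep : ∀ (N : Matroid n) {k S} → (∀ S → ∣ S ∣ ≡ suc k → Circuit N (U S)) →
                   suc k ≤ m → ∣ S ∣ ≤ k → Indep N (U S)
  few-arms-indep N {k} {S} circ k<m S≤k
    with ⊆-between S ⊤ (suc k) (λ _ → ∈⊤) (m≤n⇒m≤1+n S≤k) (≤-trans k<m (≤-reflexive (sym (∣⊤∣≡n m))))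
  ... | S' , S⊆S' , _ , ∣S'∣
    with larger⇒∃ S' S (subst (∣ S ∣ <_) (sym ∣S'∣) (s≤s S≤k))
  ... | i , i∈ , i∉ with arm-inhabited i
  ... | x , refl = proj₂ (circ S' ∣S'∣) (U S) (U-mono S⊆S' , x , ∈U⁺ i∈ , i∉ ∘ ∈U⁻)

  ∃-subset : (R : Subset m) (k : ℕ) → k ≤ ∣ R ∣ → ∃ λ S → S ⊆ R × ∣ S ∣ ≡ k
  ∃-subset R k k≤ with ⊆-between ⊥ R k (⊥-elim ∘ ∉⊥) (subst (_≤ k) (sym (∣⊥∣≡0 m)) z≤n) k≤
  ... | S , _ , S⊆ , ∣S∣ = S , S⊆ , ∣S∣

  -- A maximal independent set cannot be searched for without decidability. Instead, the empty set
  -- is a proper subset of a cocircuit, hence coindependent, and the witness of this is a basis.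
  cocircuits⇒basis : ∀ {M b} → (∀ T → ∣ T ∣ ≡ suc b → Cocircuit M (U T)) → suc b ≤ m → ∃ (IsBasis M)
  cocircuits⇒basis {b = b} cocirc b<m with ∃-subset ⊤ (suc b) (≤-trans b<m (≤-reflexive (sym (∣⊤∣≡n m))))
  ... | T , _ , ∣T∣
    with larger⇒∃ T ⊥ (subst (_< ∣ T ∣) (sym (∣⊥∣≡0 m)) (subst (0 <_) (sym ∣T∣) (s≤s z≤n)))
  ... | i , i∈T , _ with arm-inhabited i
  ... | x , refl with proj₂ (cocirc T ∣T∣) ⊥ (⊥-elim ∘ ∉⊥ , x , ∈U⁺ i∈T , ∉⊥)
  ... | B , bB , _ = B , bB

  -- A basis avoiding `U T` is used to extend `U S`; since `S` and `T` are disjoint, the result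
  -- still avoids `U T`.
  split-basis : ∀ {M a b r S T} (rk : Rank M r) → IsSpike M (suc a) (suc b) arm → suc a + suc b ≤ m →
                S ⊆ ∁ T → ∣ S ∣ ≡ a → ∣ T ∣ ≡ b → ∃ λ B → IsBasis M B × U S ⊆ B × U T ⊆ ∁ B
  split-basis {M} {a} {b} {S = S} {T} rk (_ , _ , _ , _ , circ , cocirc) le S⊆∁T ∣S∣ ∣T∣ =
    let B , bB , UT⊆∁B = few-arms-indep (dual M rk) {S = T} cocirc (m+n≤o⇒n≤o (suc a) le) (≤-reflexive ∣T∣)
        L , US⊆L , L⊆ , bL = extend-to-basis M rk
          (few-arms-indep M {S = S} circ (m+n≤o⇒m≤o (suc a) le) (≤-reflexive ∣S∣)) bB
    in L , bL , US⊆L ,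
       disjoint-sym {p = L} {q = U T} (∪-least {p = U S} {q = B} (U-disjoint S⊆∁T) (disjoint-sym UT⊆∁B) ∘ L⊆)

  -- `B` has exactly `a` full arms and its complement exactly `b`, so `B` touches `m ∸ b` arms and
  -- has `(m ∸ b) + a` elements. The equation is kept additive to avoid truncated subtraction.
  rank-by-split-basis : ∀ {M a b r S T B} (rk : Rank M r) → IsSpike M (suc a) (suc b) arm → b ≤ m →
                        ∣ S ∣ ≡ a → ∣ T ∣ ≡ b → IsBasis M B → U S ⊆ B → U T ⊆ ∁ B → r + suc b ≡ m + suc a
  rank-by-split-basis {M} {a} {b} {r} {S} {T} {B} rk (_ , _ , _ , _ , circ , cocirc) b≤m ∣S∣ ∣T∣ bB US⊆B UT⊆∁B =
    begin
    r + suc b                           ≡⟨ cong (_+ suc b) (trans (sym (basis⇒size M rk bB)) (size B)) ⟩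
    ∣ touched B ∣ + ∣ full B ∣ + suc b  ≡⟨ cong₂ (λ x y → x + y + suc b) (trans (∣touched∣ B) (cong (m ∸_) full∁B)) fullB ⟩
    (m ∸ b) + a + suc b                 ≡⟨ solve 3 (λ x a b → x :+ a :+ (con 1 :+ b) := (x :+ b) :+ (con 1 :+ a)) refl (m ∸ b) a b ⟩
    (m ∸ b) + b + suc a                 ≡⟨ cong (_+ suc a) (m∸n+n≡m b≤m) ⟩
    m + suc a                           ∎
    where
    open ≡-Reasoning
    open +-*-Solver
    fullB : ∣ full B ∣ ≡ a
    fullB = ≤-antisym (full-bound M circ (proj₁ bB))
      (≤-trans (≤-reflexive (sym ∣S∣)) (p⊆q⇒∣p∣≤∣q∣ {p = S} (full-mono US⊆B ∘ full-U)))
    full∁B : ∣ full (∁ B) ∣ ≡ b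
    full∁B = ≤-antisym (full-bound (dual M rk) cocirc (B , bB , id))
      (≤-trans (≤-reflexive (sym ∣T∣)) (p⊆q⇒∣p∣≤∣q∣ {p = T} (full-mono UT⊆∁B ∘ full-U)))

  spike-rank-≡ : ∀ {M a b r} (rk : Rank M r) → IsSpike M (suc a) (suc b) arm → suc a + suc b ≤ m →
                 r + suc b ≡ m + suc a
  spike-rank-≡ {M} {a} {b} {r} rk spike le =
    let T , _ , ∣T∣ = ∃-subset ⊤ b (≤-trans b≤m (≤-reflexive (sym (∣⊤∣≡n m))))
        S , S⊆∁T , ∣S∣ = ∃-subset (∁ T) a (≤-trans (m+n≤o⇒m≤o∸n a (≤-trans (+-mono-≤ (n≤1+n a) (n≤1+n b)) le))
           (≤-reflexive (sym (trans (∣∁p∣≡n∸∣p∣ T) (cong (m ∸_) ∣T∣)))))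
        B , bB , US⊆B , UT⊆∁B = split-basis rk spike le S⊆∁T ∣S∣ ∣T∣
    in rank-by-split-basis {S = S} {T} {B} rk spike b≤m ∣S∣ ∣T∣ bB US⊆B UT⊆∁B
    where
    b≤m : b ≤ m
    b≤m = ≤-trans (n≤1+n b) (m+n≤o⇒n≤o (suc a) le)

dual-spike : ∀ {n m} {arm : Fin n → Fin m} {M : Matroid n} {s t r} (rk : Rank M r) →
             IsSpike M s t arm → IsSpike (dual M rk) t s arm
dual-spike {M = M} {s} {t} rk (1≤s , 1≤t , le , two , circ , cocirc) =
  1≤t , 1≤s , ≤-trans (≤-reflexive (⊔-comm t s)) le , two , cocirc ,
  λ S ∣S∣ → proj₁ (circ S ∣S∣) ∘ proj₂ (dual-involutive M rk _)
          , λ Y Y⊂ → proj₁ (dual-involutive M rk Y) (proj₂ (circ S ∣S∣) Y Y⊂)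

-- Reduction of an (s, t)-spike `K` to an (s - 1, t)-spike `Q`, where s = `2 + k`, t = `suc b` and
-- r(K) = `suc r`.

module Reduction {n m : ℕ} {arm : Fin n → Fin m} (K : Matroid n) (k b r : ℕ)
  (spike : IsSpike K (2 + k) (suc b) arm) (order : 2 + k + suc b ≤ m)
  (rk : Rank K (suc r)) (r-eq : r + suc b ≡ m + suc k) where

  two : ∀ i → ∣ armSet arm i ∣ ≡ 2
  two = proj₁ (proj₂ (proj₂ (proj₂ spike)))

  circuits : ∀ S → ∣ S ∣ ≡ 2 + k → Circuit K (unionArms arm S)
  circuits = proj₁ (proj₂ (proj₂ (proj₂ (proj₂ spike))))

  cocircuits : ∀ S → ∣ S ∣ ≡ suc b → Cocircuit K (unionArms arm S)
  cocircuits = proj₂ (proj₂ (proj₂ (proj₂ (proj₂ spike))))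

  open Arms arm two

  -- A cocircuit of t arms through x that avoids S shows that x is not in the closure of U S.
  add-new-arm : ∀ {I S x} → Indep K I → I ⊆ U S → ∣ S ∣ + suc b ≤ m → arm x ∉ S → Indep K (I ∪ ⁅ x ⁆)
  add-new-arm {I} {S} {x} iI I⊆US S+t≤m x∉S
    with ⊆-between ⁅ arm x ⁆ (∁ S) (suc b) (⁅⁆⊆ (x∉p⇒x∈∁p x∉S))
           (subst (_≤ suc b) (sym (∣⁅x⁆∣≡1 (arm x))) (s≤s z≤n))
           (≤-trans (m+n≤o⇒m≤o∸n (suc b) (≤-trans (≤-reflexive (+-comm (suc b) ∣ S ∣)) S+t≤m))
             (≤-reflexive (sym (∣∁p∣≡n∸∣p∣ S))))
  ... | T , x∈T , T⊆∁S , ∣T∣ with cocircuits T ∣T∣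
  ... | codep , coindep with coindep (U T - x) (x∈p⇒p-x⊂p (∈U⁺ (x∈T (x∈⁅x⁆ (arm x)))))
  -- `B` meets `U T` in at most `x`. No basis avoids the cocircuit `U T`, so `x` lies in `B`.
  ... | B , bB , UT-x⊆∁B = conclude
    where
    no-basis : ∀ {L} → Indep K L → ∣ L ∣ ≡ suc r → ¬ (L ⊆ ∁ (U T))
    no-basis iL ∣L∣ L⊆ = codep (_ , size⇒basis K rk iL ∣L∣ , disjoint-sym L⊆)
    I⊆∁UT : I ⊆ ∁ (U T)
    I⊆∁UT = disjoint-sym (U-disjoint T⊆∁S) ∘ I⊆US
    B⊆ : ∀ {y} → y ∈ B → y ≢ x → y ∈ ∁ (U T)
    B⊆ y∈B y≢x = x∉p⇒x∈∁p λ y∈UT → x∈∁p⇒x∉p (UT-x⊆∁B (x∈p∧x≢y⇒x∈p-y y∈UT y≢x)) y∈B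
    x∈B : x ∈ B
    x∈B with x ∈? B
    ... | yes x∈ = x∈
    ... | no x∉ = ⊥-elim (no-basis (proj₁ bB) (basis⇒size K rk bB)
                    (λ y∈B → B⊆ y∈B λ { refl → x∉ y∈B }))
    ∣B-x∣ : ∣ B - x ∣ ≡ r
    ∣B-x∣ = suc-injective (trans (suc∣p-x∣ x∈B) (basis⇒size K rk bB))
    I≤r : ∣ I ∣ ≤ r
    I≤r = s≤s⁻¹ (≤∧≢⇒< (bound rk iI) (λ ∣I∣ → no-basis iI ∣I∣ I⊆∁UT))
    B-x⊆ : B - x ⊆ ∁ (U T)
    B-x⊆ y∈ = B⊆ (p─q⊆p B ⁅ x ⁆ y∈) λ { refl → x∉p-x B y∈ }
    conclude : Indep K (I ∪ ⁅ x ⁆)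
    -- `L` stays outside `U T`. Augmenting it from `B` to a basis must add `x`, as any other element
    -- of `B` would give a basis avoiding `U T`.
    conclude with extend K r iI (indep-⊆ K (p─q⊆p B ⁅ x ⁆) (proj₁ bB)) I≤r (≤-reflexive (sym ∣B-x∣))
    ... | L , I⊆L , L⊆ , iL , ∣L∣
      with indep-aug K iL (proj₁ bB) (≤-reflexive (trans (cong suc ∣L∣) (sym (basis⇒size K rk bB))))
    ... | y , y∈B , y∉L , iLy with y ≟ x
    ... | yes refl = indep-⊆ K (∪-monoˡ ⁅ x ⁆ I⊆L) iLy
    ... | no y≢x = ⊥-elim (no-basis iLy (trans (∣p∪⁅x⁆∣ y∉L) (cong suc ∣L∣))
                     (∪-least (∪-least I⊆∁UT B-x⊆ ∘ L⊆) (⁅⁆⊆ (B⊆ y∈B y≢x))))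

  -- `r-eq` is the rank formula lowered by one on both sides. It turns a bound on size into t
  -- untouched arms, the room that `add-new-arm` needs.
  touched-small : ∀ {I} → suc k + ∣ touched I ∣ ≤ r → ∣ touched I ∣ + suc b ≤ m
  touched-small {I} le = +-cancelˡ-≤ (suc k) _ _ (begin
    suc k + (∣ touched I ∣ + suc b)  ≡⟨ +-assoc (suc k) ∣ touched I ∣ (suc b) ⟨
    suc k + ∣ touched I ∣ + suc b    ≤⟨ +-monoˡ-≤ (suc b) le ⟩
    r + suc b                        ≡⟨ r-eq ⟩
    m + suc k                        ≡⟨ +-comm m (suc k) ⟩
    suc k + m                        ∎)
    where open ≤-Reasoning

  -- Ordinary exchange could complete an arm and break the cap on full arms. An element from an arm
  -- untouched by `I` leaves the number of full arms unchanged.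
  aug-new-arm : ∀ {I J} → Indep K I → suc k + ∣ touched I ∣ ≤ r → ∣ touched I ∣ + ∣ full J ∣ < ∣ J ∣ →
                ∃ λ x → x ∈ J × x ∉ I × Indep K (I ∪ ⁅ x ⁆) × ∣ full (I ∪ ⁅ x ⁆) ∣ ≤ ∣ full I ∣
  aug-new-arm {I} {J} iI small lt with larger-touches-more {I} {J} lt
  ... | x , x∈J , x∉ = x , x∈J , x∉ ∘ touched⁺ ,
        add-new-arm iI ⊆-U-touched (touched-small {I} small) x∉ , full-∪⁅x⁆-untouched x∉

  -- Since r(K) = suc r, the bound on |I| excludes exactly the bases of K.
  QIndep : Subset n → Set
  QIndep I = Indep K I × ∣ I ∣ ≤ r × ∣ full I ∣ ≤ k

  Q-⊥ : QIndep ⊥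
  Q-⊥ = indep-⊥ K , subst (_≤ r) (sym (∣⊥∣≡0 n)) z≤n ,
        ≤-trans (p⊆q⇒∣p∣≤∣q∣ (full-⊆ {S = ⊥} (⊥-elim ∘ ∉⊥))) (subst (_≤ k) (sym (∣⊥∣≡0 m)) z≤n)

  Q-⊆ : ∀ {I J} → J ⊆ I → QIndep I → QIndep J
  Q-⊆ J⊆I (iI , I≤r , f≤k) = indep-⊆ K J⊆I iI , ≤-trans (p⊆q⇒∣p∣≤∣q∣ J⊆I) I≤r ,
                             ≤-trans (p⊆q⇒∣p∣≤∣q∣ (full-mono J⊆I)) f≤k

  -- The last hypothesis covers both J independent in Q with |I| < |J| and J independent in K with |I| + 1 < |J|.
  Q-aug : ∀ {I J} → QIndep I → Indep K J → ∣ I ∣ < ∣ J ∣ → ∣ I ∣ < r → ∣ I ∣ + ∣ full J ∣ < k + ∣ J ∣ →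
          ∃ λ x → x ∈ J × x ∉ I × QIndep (I ∪ ⁅ x ⁆)
  Q-aug {I} {J} (iI , I≤r , f≤k) iJ I<J I<r lt with suc ∣ full I ∣ ≤? k
  ... | yes f<k =
    let x , x∈J , x∉I , iIx = indep-aug K iI iJ I<J
    in x , x∈J , x∉I , iIx , ≤-trans (≤-reflexive (∣p∪⁅x⁆∣ x∉I)) I<r , ≤-trans (full-∪⁅x⁆ x∉I) f<k
  -- `I` has exactly `k` full arms, so its size is `k` plus its number of touched arms, and `lt`
  -- says that `J` touches more arms.
  ... | no f≮k =
    let x , x∈J , x∉I , iIx , f≤ = aug-new-arm {I} {J} iI (subst (_< r) ∣I∣ I<r) touched+full<
    in x , x∈J , x∉I , iIx , ≤-trans (≤-reflexive (∣p∪⁅x⁆∣ x∉I)) I<r , ≤-trans f≤ f≤k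
    where
    ∣I∣ : ∣ I ∣ ≡ k + ∣ touched I ∣
    ∣I∣ = trans (size I) (trans (cong (∣ touched I ∣ +_) (≤-antisym f≤k (≮⇒≥ f≮k))) (+-comm ∣ touched I ∣ k))
    touched+full< : ∣ touched I ∣ + ∣ full J ∣ < ∣ J ∣
    touched+full< = +-cancelˡ-< k _ _ (subst (_< k + ∣ J ∣)
      (trans (cong (_+ ∣ full J ∣) ∣I∣) (+-assoc k ∣ touched I ∣ ∣ full J ∣)) lt)

  Q : Matroid n
  Q = record
    { Indep = QIndep ; indep-⊥ = Q-⊥ ; indep-⊆ = Q-⊆
    ; indep-aug = λ { qI (iJ , J≤r , fJ≤k) I<J → Q-aug qI iJ I<J (≤-trans I<J J≤r)
        (≤-trans (+-mono-≤ I<J fJ≤k) (≤-reflexive (+-comm _ k))) }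
    }

  -- Deleting the new element gives `K`, and contracting it gives `Q`.
  KeIndep : Subset (suc n) → Set
  KeIndep (false ∷ I) = Indep K I
  KeIndep (true ∷ I) = QIndep I

  Ke-⊆ : ∀ {I J} → J ⊆ I → KeIndep I → KeIndep J
  Ke-⊆ {false ∷ I} {false ∷ J} J⊆I iI = indep-⊆ K (drop-∷-⊆ J⊆I) iI
  Ke-⊆ {true ∷ I} {false ∷ J} J⊆I iI = indep-⊆ K (drop-∷-⊆ J⊆I) (proj₁ iI)
  Ke-⊆ {true ∷ I} {true ∷ J} J⊆I iI = Q-⊆ (drop-∷-⊆ J⊆I) iI
  Ke-⊆ {false ∷ I} {true ∷ J} J⊆I iI with J⊆I here
  ... | ()

  K-full-bound : ∀ {I} → Indep K I → ∣ full I ∣ ≤ suc k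
  K-full-bound = full-bound two K circuits

  lift-aug : ∀ {c d I J} → (∃ λ x → x ∈ J × x ∉ I × KeIndep (c ∷ (I ∪ ⁅ x ⁆))) →
             ∃ λ x → x ∈ d ∷ J × x ∉ c ∷ I × KeIndep ((c ∷ I) ∪ ⁅ x ⁆)
  lift-aug {c} {I = I} (x , x∈J , x∉I , i) =
    suc x , there x∈J , x∉I ∘ drop-there , subst (λ d → KeIndep (d ∷ (I ∪ ⁅ x ⁆))) (sym (∨-identityʳ c)) i

  Ke-aug : ∀ {I J} → KeIndep I → KeIndep J → ∣ I ∣ < ∣ J ∣ →
           ∃ λ x → x ∈ J × x ∉ I × KeIndep (I ∪ ⁅ x ⁆)
  Ke-aug {false ∷ I} {false ∷ J} iI iJ I<J = lift-aug (indep-aug K iI iJ I<J)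
  Ke-aug {true ∷ I} {true ∷ J} qI qJ I<J = lift-aug (indep-aug Q qI qJ (s≤s⁻¹ I<J))
  -- `J` may have `suc k` full arms, but it exceeds `I` by at least two elements, which compensates.
  Ke-aug {true ∷ I} {false ∷ J} qI iJ I<J =
    lift-aug (Q-aug qI iJ (≤-trans (n≤1+n _) I<J) (s≤s⁻¹ (≤-trans I<J (bound rk iJ))) (begin-strict
      ∣ I ∣ + ∣ full J ∣  ≤⟨ +-monoʳ-≤ ∣ I ∣ (K-full-bound iJ) ⟩
      ∣ I ∣ + suc k       ≡⟨ solve 2 (λ i k → i :+ (con 1 :+ k) := k :+ (con 1 :+ i)) refl ∣ I ∣ k ⟩
      k + suc ∣ I ∣       <⟨ +-monoʳ-< k I<J ⟩
      k + ∣ J ∣           ∎))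
    where open ≤-Reasoning
          open +-*-Solver
  Ke-aug {false ∷ I} {true ∷ J} iI (iJ , J≤r , fJ≤k) I<J with suc ∣ I ∣ ≤? ∣ J ∣ | ∣ full I ∣ ≤? k
  ... | yes I<J' | _ = lift-aug (indep-aug K iI iJ I<J')
  ... | no _ | yes f≤k = zero , here , (λ ()) ,
                         subst QIndep (sym (∪-identityʳ I)) (iI , ≤-trans (s≤s⁻¹ I<J) J≤r , f≤k)
  ... | no _ | no f≰k =
    let x , x∈ , x∉ , i , _ = aug-new-arm {I} {J} iI (subst (_≤ r) ∣I∣ (≤-trans (s≤s⁻¹ I<J) J≤r)) touched+full<
    in lift-aug (x , x∈ , x∉ , i)
    where
    ∣I∣ : ∣ I ∣ ≡ suc k + ∣ touched I ∣
    ∣I∣ = trans (size I) (trans (cong (∣ touched I ∣ +_) (≤-antisym (K-full-bound iI) (≰⇒> f≰k))) (+-comm ∣ touched I ∣ (suc k)))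
    open ≤-Reasoning
    touched+full< : ∣ touched I ∣ + ∣ full J ∣ < ∣ J ∣
    touched+full< = begin-strict
      ∣ touched I ∣ + ∣ full J ∣  ≤⟨ +-monoʳ-≤ ∣ touched I ∣ fJ≤k ⟩
      ∣ touched I ∣ + k           ≡⟨ +-comm ∣ touched I ∣ k ⟩
      k + ∣ touched I ∣           <⟨ ≤-refl ⟩
      suc k + ∣ touched I ∣       ≡⟨ ∣I∣ ⟨
      ∣ I ∣                       ≤⟨ s≤s⁻¹ I<J ⟩
      ∣ J ∣                       ∎

  Ke : Matroid (suc n)
  Ke = record { Indep = KeIndep ; indep-⊥ = indep-⊥ K ; indep-⊆ = Ke-⊆ ; indep-aug = Ke-aug }

  rkKe : Rank Ke (suc r)
  rkKe = record { base = false ∷ base rk ; base-indep = base-indep rk ; base-size = base-size rk ; bound = λ {I} → bd {I} }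
    where
    bd : ∀ {I} → KeIndep I → ∣ I ∣ ≤ suc r
    bd {false ∷ I} iI = bound rk iI
    bd {true ∷ I} (_ , I≤r , _) = s≤s I≤r

  shrink-basis : ∀ {B} → IsBasis K B → ∃ λ L → L ⊆ B × QIndep L × ∣ L ∣ ≡ r
  shrink-basis {B} bB =
    let x , x∈B , f≤k = remove-from-full {B} (subst (0 <_) (sym (basis⇒size K rk bB)) (s≤s z≤n)) (K-full-bound (proj₁ bB))
        ∣B-x∣ = suc-injective (trans (suc∣p-x∣ x∈B) (basis⇒size K rk bB))
    in B - x , p─q⊆p B ⁅ x ⁆ , (indep-⊆ K (p─q⊆p B ⁅ x ⁆) (proj₁ bB) , ≤-reflexive ∣B-x∣ , f≤k) , ∣B-x∣

  rkQ : Rank Q r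
  rkQ =
    let L , _ , qL , ∣L∣ = shrink-basis (size⇒basis K rk (base-indep rk) (base-size rk))
    in record { base = L ; base-indep = qL ; base-size = ∣L∣ ; bound = λ { (_ , I≤r , _) → I≤r } }

  -- Circuits and cocircuits of `Q`.

  K-coindep⇒Q-coindep : ∀ {X} → DualIndep K X → DualIndep Q X
  K-coindep⇒Q-coindep (B , bB , X⊆) =
    let L , L⊆B , qL , ∣L∣ = shrink-basis bB
    in L , size⇒basis Q rkQ qL ∣L∣ , p⊆q⇒∁p⊇∁q L⊆B ∘ X⊆

  many-arms-Q-dep : ∀ S {I} → ∣ S ∣ ≡ suc k → U S ⊆ I → ¬ QIndep I
  many-arms-Q-dep S ∣S∣ US⊆I (_ , _ , f≤k) =
    <⇒≱ (≤-reflexive (sym ∣S∣)) (≤-trans (p⊆q⇒∣p∣≤∣q∣ {p = S} (full-mono US⊆I ∘ full-U)) f≤k)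

  US-indep : ∀ S → ∣ S ∣ ≡ suc k → Indep K (U S)
  US-indep S ∣S∣ = few-arms-indep two K {S = S} circuits (≤-trans (m≤m+n (2 + k) (suc b)) order) (≤-reflexive ∣S∣)

  -- Losing an element of `U S` brings the size down to at most `r` and breaks one of the `suc k`
  -- full arms, so both caps hold.
  Q-circuit : ∀ S → ∣ S ∣ ≡ suc k → Circuit Q (U S)
  Q-circuit S ∣S∣ = many-arms-Q-dep S ∣S∣ id , λ { Y (Y⊆ , x , x∈ , x∉) →
      indep-⊆ K Y⊆ (US-indep S ∣S∣)
    , s≤s⁻¹ (≤-trans (p⊂q⇒∣p∣<∣q∣ (Y⊆ , x , x∈ , x∉)) (bound rk (US-indep S ∣S∣)))
    , s≤s⁻¹ (subst (∣ full Y ∣ <_) ∣S∣ (p⊂q⇒∣p∣<∣q∣ {q = S}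
        (full-⊆ Y⊆ , arm x , ∈U⁻ {S} x∈ , λ i∈ → x∉ (full⁻ i∈ (∈arm x))))) }

  -- A basis of `Q` avoiding t arms would have at most `(m ∸ suc b) + k` elements, one fewer than
  -- the rank `r`. Minimality is inherited from `K`.
  Q-cocircuit : ∀ T → ∣ T ∣ ≡ suc b → Cocircuit Q (U T)
  Q-cocircuit T ∣T∣ = codep , λ Y Y⊂ → K-coindep⇒Q-coindep (proj₂ (cocircuits T ∣T∣) Y Y⊂)
    where
    t≤m : suc b ≤ m
    t≤m = ≤-trans (m≤n+m (suc b) (2 + k)) order
    codep : ¬ DualIndep Q (U T)
    codep (B , bB , UT⊆∁B) = <⇒≱ {m + k} (+-monoʳ-< m ≤-refl) (begin
      m + suc k                                   ≡⟨ r-eq ⟨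
      r + suc b                                   ≡⟨ cong (_+ suc b) (trans (sym (basis⇒size Q rkQ bB)) (size B)) ⟩
      ∣ touched B ∣ + ∣ full B ∣ + suc b          ≤⟨ +-monoˡ-≤ (suc b) (+-mono-≤ touched≤ (proj₂ (proj₂ (proj₁ bB)))) ⟩
      (m ∸ suc b) + k + suc b                     ≡⟨ solve 3 (λ x k t → x :+ k :+ t := x :+ t :+ k) refl (m ∸ suc b) k (suc b) ⟩
      (m ∸ suc b) + suc b + k                     ≡⟨ cong (_+ k) (m∸n+n≡m t≤m) ⟩
      m + k                                       ∎)
      where
      open ≤-Reasoning
      open +-*-Solver
      T⊆ : T ⊆ full (∁ B)
      T⊆ = full-mono UT⊆∁B ∘ full-U
      touched≤ : ∣ touched B ∣ ≤ m ∸ suc b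
      touched≤ = subst (_≤ m ∸ suc b) (sym (∣touched∣ B)) (∸-monoʳ-≤ m (subst (_≤ ∣ full (∁ B) ∣) ∣T∣ (p⊆q⇒∣p∣≤∣q∣ T⊆)))

  Q-spike : IsSpike Q (suc k) (suc b) arm
  Q-spike = s≤s z≤n , s≤s z≤n , ⊔-lub (≤-trans (≤-trans (n≤1+n _) (m≤m+n (2 + k) (suc b))) order) (≤-trans (m≤n+m (suc b) (2 + k)) order) ,
            two , Q-circuit , Q-cocircuit

  -- The quotient step from the dual of `Q` to the dual of `K`.

  dual-quotient-step : QuotStepWith (suc b) (suc k) arm (dual Q rkQ) (dual K rk)
  dual-quotient-step = dual-spike rkQ Q-spike
    , ≤-trans (≤-reflexive (+-comm (suc b) (suc k))) (≤-trans (n≤1+n _) order)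
    , dual Ke rkKe , extension , not-spanned , contraction
    where
    extension : IsExtension (dual Ke rkKe) (dual Q rkQ)
    extension X = to , from
      where
      to : DualIndep Ke (false ∷ X) → DualIndep Q X
      to (true ∷ B , bB , X⊆) = B , size⇒basis Q rkQ (proj₁ bB) (suc-injective (basis⇒size Ke rkKe bB)) , drop-∷-⊆ X⊆
      to (false ∷ B , bB , X⊆) = K-coindep⇒Q-coindep
        (B , size⇒basis K rk (proj₁ bB) (basis⇒size Ke rkKe bB) , drop-∷-⊆ X⊆)
      from : DualIndep Q X → DualIndep Ke (false ∷ X)
      from (B , bB , X⊆) = true ∷ B , size⇒basis Ke rkKe (proj₁ bB) (cong suc (basis⇒size Q rkQ bB)) , out⊆ X⊆
    extend-K-coindep : ∀ {X} → DualIndep K X → DualIndep Ke (true ∷ X)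
    extend-K-coindep (B , bB , X⊆) = false ∷ B , size⇒basis Ke rkKe (proj₁ bB) (basis⇒size K rk bB) , in⊆in X⊆
    contraction : IsContractionOfNew (dual Ke rkKe) (dual K rk)
    contraction X = inj₁ ∘ extend-K-coindep , from
      where
      from : ContractIndep (dual Ke rkKe) X → DualIndep K X
      from (inj₁ (true ∷ B , _ , X⊆)) with X⊆ here
      ... | ()
      from (inj₁ (false ∷ B , bB , X⊆)) = B , size⇒basis K rk (proj₁ bB) (basis⇒size Ke rkKe bB) , drop-∷-⊆ X⊆
      -- A basis of `K` is a basis of `Ke` avoiding the new element, which is therefore not a loop
      -- of the dual.
      from (inj₂ (e-loop , _)) = ⊥-elim (e-loop (extend-K-coindep (indep-⊥ (dual K rk))))
    -- Let `I` be a largest coindependent set in the complement of `U S`, and extend `U S` to a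
    -- basis `L` of `Ke` avoiding `I`. `L` contains `suc k` arms, so it omits the new element;
    -- adding that element to `I` keeps it coindependent and raises the rank.
    not-spanned : ∀ S → ∣ S ∣ ≡ suc k → ¬ InClosure (dual Ke rkKe) (false ∷ ∁ (U S)) zero
    not-spanned S ∣S∣ (c , ((true ∷ I , I⊆ , _) , _) , _) with I⊆ here
    ... | ()
    not-spanned S ∣S∣ (c , ((false ∷ I , I⊆ , (B , bB , I⊆∁B) , ∣I∣) , _) , (_ , bd)) =
      absurd (extend-to-basis Ke rkKe {I = false ∷ U S} (US-indep S ∣S∣) bB)
      where
      absurd : ¬ (∃ λ L → false ∷ U S ⊆ L × L ⊆ (false ∷ U S) ∪ B × IsBasis Ke L)
      absurd (true ∷ L , US⊆L , _ , bL) = many-arms-Q-dep S ∣S∣ (drop-∷-⊆ US⊆L) (proj₁ bL)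
      absurd (false ∷ L , _ , L⊆ , bL) = <⇒≱ ≤-refl (≤-trans (≤-reflexive (cong suc (sym ∣I∣)))
            (bd (true ∷ I) (in⊆in (p⊆p∪q ⊥ ∘ drop-∷-⊆ I⊆))
              (false ∷ L , bL , in⊆in (drop-∷-⊆ I⊆∁L))))
        where
        I⊆∁L : false ∷ I ⊆ ∁ (false ∷ L)
        I⊆∁L = disjoint-sym (∪-least {r = ∁ (false ∷ I)} (disjoint-sym (out⊆ (drop-∷-⊆ I⊆))) (disjoint-sym I⊆∁B) ∘ L⊆)

-- The step is stated between duals so that it serves twice: inside a dual step ending at `K`, and,
-- with `K` itself a dual, as a quotient step.
reduce : ∀ {n m} {arm : Fin n → Fin m} {K : Matroid n} {k b} →
         IsSpike K (2 + k) (suc b) arm → 2 + k + suc b ≤ m →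
         Σ (Matroid n) λ Q → IsSpike Q (suc k) (suc b) arm
           × ∃ λ r → Σ (Rank Q r) λ rkQ → ∃ λ r′ → Σ (Rank K r′) λ rkK →
             QuotStepWith (suc b) (suc k) arm (dual Q rkQ) (dual K rkK)
reduce {m = m} {K = K} {k} {b} spike@(_ , _ , _ , two , _ , cocirc) order =
  go (basis⇒rank K (proj₂ (cocircuits⇒basis two {K} cocirc (m+n≤o⇒n≤o (2 + k) order))))
  where
  go : ∀ {r} → Rank K r → _
  -- In rank zero the rank formula would read `suc b ≡ m + (2 + k)`, impossible as `suc b` is less
  -- than `m`.
  go {zero} rk = contradiction (spike-rank-≡ two rk spike order)
    (<⇒≢ (≤-trans (m≤n+m (2 + b) (suc k))
      (≤-trans (≤-reflexive (+-suc (suc k) (suc b))) (≤-trans order (m≤m+n m (2 + k))))))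
  go {suc r} rk = Q , Q-spike , r , rkQ , suc r , rk , dual-quotient-step
    where open Reduction K k b r spike order rk
            (suc-injective (trans (spike-rank-≡ two rk spike order) (+-suc m (suc k))))

opaque
  dual-step : ∀ {n m} {arm : Fin n → Fin m} {M : Matroid n} {k b} →
              IsSpike M (2 + k) (suc b) arm → 2 + k + suc b ≤ m →
              Σ (Matroid n) λ N → IsSpike N (suc k) (suc b) arm × DualStep N M
  dual-step {m = m} {arm} {M} {k} {b} spike order =
    let Q , Q-spike , _ , rkQ , _ , rkM , step = reduce spike order
    in Q , Q-spike , m , suc k , suc b , arm , Q-spike , ≤-trans (n≤1+n _) order ,
       dual Q rkQ , (λ _ → id , id) , dual M rkM , step , dual-involutive M rkM

  -- The reduction of the dual of `M` yields a quotient step to the double dual, which has the same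
  -- independent sets as `M`; the contraction condition sees only these.
  quotient-step : ∀ {n m} {arm : Fin n → Fin m} {M : Matroid n} {a k} →
                  IsSpike M (suc a) (2 + k) arm → suc a + (2 + k) ≤ m →
                  Σ (Matroid n) λ N → IsSpike N (suc a) (suc k) arm × QuotStep N M
  quotient-step {m = m} {arm} {M} {a} {k} spike@(_ , _ , _ , two , _ , cocirc) order =
    let _ , basis = cocircuits⇒basis two {M} cocirc (m+n≤o⇒n≤o (suc a) order)
        rk = basis⇒rank M basis
        Q , Q-spike , _ , rkQ , _ , rk* , (N-spike , N-order , Ne , ext , free , contr) =
          reduce (dual-spike rk spike) (≤-trans (≤-reflexive (+-comm (2 + k) (suc a))) order)
        same : SameMatroid (dual (dual M rk) rk*) M
        same X = proj₂ (dual-involutive M rk X) , proj₁ (dual-involutive M rk X)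
    in dual Q rkQ , N-spike , m , suc a , suc k , arm , N-spike , N-order , Ne , ext , free ,
       λ X → proj₁ (contr X) ∘ proj₂ (same X) , proj₁ (same X) ∘ proj₂ (contr X)

-- Sequences of steps

module _ {n : ℕ} where

  -- The terms are indexed by all naturals, and those beyond `k` are unconstrained.
  record Sequence (P : Matroid n → Set) (Step : ℕ → Matroid n → Matroid n → Set₁)
                  (k : ℕ) (M : Matroid n) : Set₁ where
    field
      Ms    : ℕ → Matroid n
      last  : Ms k ≡ M
      start : P (Ms 0)
      steps : ∀ i → suc i ≤ k → Step i (Ms i) (Ms (suc i))

  open Sequence

  snoc : ∀ {P Step k N M} → Sequence P Step k N → Step k N M → Sequence P Step (suc k) M
  snoc {P} {Step} {k} {N} {M} seq step = record
    { Ms = Ms′ ; last = Ms′-last ; start = subst P (sym (Ms′-old z≤n)) (start seq) ; steps = steps′ }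
    where
    Ms′ : ℕ → Matroid n
    Ms′ i with i ≤? k
    ... | yes _ = Ms seq i
    ... | no _ = M
    Ms′-old : ∀ {i} → i ≤ k → Ms′ i ≡ Ms seq i
    Ms′-old {i} i≤k with i ≤? k
    ... | yes _ = refl
    ... | no i≰k = contradiction i≤k i≰k
    Ms′-last : Ms′ (suc k) ≡ M
    Ms′-last with suc k ≤? k
    ... | yes k<k = contradiction k<k 1+n≰n
    ... | no _ = refl
    steps′ : ∀ i → suc i ≤ suc k → Step i (Ms′ i) (Ms′ (suc i))
    steps′ i (s≤s i≤k) with m≤n⇒m<n∨m≡n i≤k
    ... | inj₁ i<k = subst₂ (Step i) (sym (Ms′-old i≤k)) (sym (Ms′-old i<k)) (steps seq i i<k)
    ... | inj₂ refl = subst₂ (Step k) (sym (trans (Ms′-old ≤-refl) (last seq))) (sym Ms′-last) step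

  map-steps : ∀ {P Step Step′ k M} → (∀ {i N N′} → suc i ≤ k → Step i N N′ → Step′ i N N′) →
              Sequence P Step k M → Sequence P Step′ k M
  map-steps f seq = record
    { Ms = Ms seq ; last = last seq ; start = start seq ; steps = λ i i<k → f i<k (steps seq i i<k) }

  -- Step `i` leads from term `i` to term `suc i`, and `t` is one less than the spike parameter: the
  -- first `t` steps are quotient steps and the later ones dual steps.
  StepAt : ℕ → ℕ → Matroid n → Matroid n → Set₁
  StepAt t i N N′ = (suc i ≤ t → QuotStep N N′) × (t ≤ i → DualStep N N′)

  -- The recursion runs backwards from `M`. Dual steps come last, so the first parameter is reduced
  -- to 1 before the second.
  spike-sequence : ∀ {m} {arm : Fin n → Fin m} s t {M} →
                   IsSpike M (suc s) (suc t) arm → suc s + suc t ≤ m →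
                   Sequence (λ N → IsSpike N 1 1 arm) (StepAt t) (s + t) M
  spike-sequence zero zero {M} spike _ = record { Ms = λ _ → M ; last = refl ; start = spike ; steps = λ _ () }
  spike-sequence zero (suc t) {M} spike order =
    let N , N-spike , step = quotient-step {M = M} spike order
    -- All earlier indices lie below `t`, so they remain quotient steps when the threshold rises to
    -- `suc t`.
    in snoc {N = N} (map-steps (λ i<t (quot , _) → (λ _ → quot i<t) , λ t<i → contradiction i<t (<⇒≯ t<i))
              (spike-sequence zero t {N} N-spike (≤-trans (n≤1+n _) order)))
         ((λ _ → step) , λ t<t → contradiction t<t 1+n≰n)
  spike-sequence (suc s) t {M} spike order =
    let N , N-spike , step = dual-step {M = M} spike order
    in snoc {N = N} (spike-sequence s t {N} N-spike (≤-trans (n≤1+n _) order))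
         ((λ s+t<t → contradiction (m≤n+m t s) (<⇒≱ s+t<t)) , λ _ → step)

open Sequence

theorem5p11 : (n s t m : ℕ) (M : Matroid n) (arm : Fin n → Fin m) →
    IsSpike M s t arm → s + t ≤ m →
    Σ (ℕ → Matroid n) λ Ms →
    SameMatroid (Ms (s + t ∸ 2)) M
    × Σ (Fin n → Fin m) (λ arm₀ → IsSpike (Ms 0) 1 1 arm₀)
    × (∀ i → suc i ≤ t ∸ 1 → QuotStep (Ms i) (Ms (suc i)))
    × (∀ i → t ≤ suc i → suc i ≤ s + t ∸ 2 → DualStep (Ms i) (Ms (suc i)))
theorem5p11 n zero t m M arm (() , _) order
theorem5p11 n (suc s) zero m M arm (_ , () , _) order
-- The rewrite turns the final index `suc s + suc t ∸ 2` into `s + t`.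
theorem5p11 n (suc s) (suc t) m M arm spike order rewrite cong (_∸ 1) (+-suc s t) =
  let seq = spike-sequence s t {M} spike order
  in Ms seq
   , (λ X → subst (λ N → Indep N X) (last seq) , subst (λ N → Indep N X) (sym (last seq)))
   , (arm , start seq)
   , (λ i i<t → proj₁ (steps seq i (≤-trans i<t (m≤n+m t s))) i<t)
   , λ i t≤i i<s+t → proj₂ (steps seq i i<s+t) (s≤s⁻¹ t≤i)
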